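{- Let $(g_n(\lambda))_{n\ge 0}$ be the sequence of polynomials in $\lambda$ defined by $g_0(\lambda)=1$ and, for $n\ge 1$, $$g_{n}(\lambda) = (2-\lambda)g_{n-1}(\lambda) + \sum_{i=2}^{n}(-1)^{i+1}2^{2i-1}g_{n-i}(\lambda).$$ Then for all $n\ge 0$, $$g_{n}(\lambda) = \sum_{t=0}^{n}\sum_{k=t}^{n}(-1)^k\binom{k}{t}\binom{t+1}{n-k}2^{2n-t-k}\lambda^{t}.$$
   Context: Empty sums are $0$; $\binom{a}{b}=0$ for integers $0\le a<b$. -}

module Defs where

open import Data.Nat.Base as ℕ using (ℕ; zero; suc; _∸_; _≥_)
open import Data.Integer.Base as ℤ using (ℤ; +_; -1ℤ; 0ℤ; 1ℤ)
open import Data.List.Base using (List; []; _∷_; map; foldr; applyUpTo)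
open import Data.Product.Base using (_×_; _,_; ∃)
open import Relation.Binary.PropositionalEquality using (_≡_; refl; cong)

infix  4 _≈_
infixl 6 _⊞_ _⊟_
infixl 7 _⊠_
infixr 7 _·_
infixr 8 _^_

-- Elements of ℤ[λ], as coefficient lists with the constant term first.
-- Trailing zeros are allowed, so equality of polynomials is _≈_, not _≡_.

Poly : Set
Poly = List ℤ

coeff : Poly → ℕ → ℤ
coeff []      _       = 0ℤ
coeff (a ∷ p) zero    = a
coeff (a ∷ p) (suc k) = coeff p k

_≈_ : Poly → Poly → Set
p ≈ q = ∀ k → coeff p k ≡ coeff q k

const : ℤ → Poly
const a = a ∷ []

X : Poly
X = 0ℤ ∷ 1ℤ ∷ []

_·_ : ℤ → Poly → Poly
a · p = map (a ℤ.*_) p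

_⊞_ : Poly → Poly → Poly
[]      ⊞ q       = q
(a ∷ p) ⊞ []      = a ∷ p
(a ∷ p) ⊞ (b ∷ q) = (a ℤ.+ b) ∷ (p ⊞ q)

_⊟_ : Poly → Poly → Poly
p ⊟ q = p ⊞ (-1ℤ · q)

_⊠_ : Poly → Poly → Poly
[]      ⊠ q = []
(a ∷ p) ⊠ q = (a · q) ⊞ (0ℤ ∷ (p ⊠ q))

_^_ : Poly → ℕ → Poly
p ^ zero  = const 1ℤ
p ^ suc n = p ⊠ (p ^ n)

-- The sum of f i over a ≤ i ≤ b, which is zero when b < a.

sum : ℕ → ℕ → (ℕ → Poly) → Poly
sum a b f = foldr _⊞_ [] (applyUpTo (λ j → f (a ℕ.+ j)) (suc b ∸ a))

infix 5 sum
syntax sum a b (λ i → p) = ∑[ a ≤ i ≤ b ] p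

-- Used only for i ≥ 2, where 2 * i ∸ 1 is the integer 2i - 1.

recCoeff : ℕ → ℤ
recCoeff i = -1ℤ ℤ.^ (i ℕ.+ 1) ℤ.* (+ 2) ℤ.^ (2 ℕ.* i ∸ 1)

IsG : (ℕ → Poly) → Set
IsG g =
    g 0 ≈ const 1ℤ
  × (∀ n → n ≥ 1 →
       g n ≈ (const (+ 2) ⊟ X) ⊠ g (n ∸ 1)
             ⊞ (∑[ 2 ≤ i ≤ n ] recCoeff i · g (n ∸ i)))

-- IsG is not vacuous: g₀ satisfies it.

mutual
  g₀ : ℕ → Poly
  g₀ zero    = const 1ℤ
  g₀ (suc n) = (const (+ 2) ⊟ X) ⊠ g₀ n
               ⊞ convolve (λ j → recCoeff (2 ℕ.+ j)) n

  -- convolve c n = Σ_{j<n} c j · g₀ (n - 1 - j)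
  convolve : (ℕ → ℤ) → ℕ → Poly
  convolve c zero    = []
  convolve c (suc n) = c 0 · g₀ n ⊞ convolve (λ j → c (suc j)) n

convolve-sum : ∀ c n →
  convolve c n ≡ foldr _⊞_ [] (applyUpTo (λ j → c j · g₀ (n ∸ suc j)) n)
convolve-sum c zero    = refl
convolve-sum c (suc n) =
  cong (c 0 · g₀ n ⊞_) (convolve-sum (λ j → c (suc j)) n)

IsG-inhabited : ∃ IsG
IsG-inhabited = g₀ , (λ _ → refl) , step
  where
  step : ∀ n → n ≥ 1 →
    g₀ n ≈ (const (+ 2) ⊟ X) ⊠ g₀ (n ∸ 1)
           ⊞ (∑[ 2 ≤ i ≤ n ] recCoeff i · g₀ (n ∸ i))
  step (suc n) _ k =
    cong (λ s → coeff ((const (+ 2) ⊟ X) ⊠ g₀ n ⊞ s) k)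
         (convolve-sum (λ j → recCoeff (2 ℕ.+ j)) n)

{-# OPTIONS --safe #-}
module Submission where

-- Write G = Σ gₙ xⁿ.  Since Σ_{i≥2} (-1)ⁱ⁺¹ 2²ⁱ⁻¹ xⁱ = -8x² / (1 + 4x), the
-- recurrence says G (1 - (2 - λ)x + 8x² / (1 + 4x)) = 1, which simplifies to
-- G (1 + 2x + λx(1 + 4x)) = 1 + 4x.  Expanding in powers of λ,
-- G = Σ_t (-λx)ᵗ (1 + 4x)ᵗ⁺¹ / (1 + 2x)ᵗ⁺¹, and the stated formula is the
-- convolution of the binomial expansions of (1 + 4x)ᵗ⁺¹ and (1 + 2x)⁻ᵗ⁻¹.

open import Defs
open import Data.Nat.Base as ℕ using (ℕ; _∸_)
open import Data.Nat.Combinatorics.Base using (_C_)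
open import Data.Integer.Base as ℤ using (+_; -1ℤ)
open import Data.Nat.Base using (zero; suc; _≤_; _<_; z≤n; s≤s)
open import Data.Nat.Combinatorics using (nCk+nC[k+1]≡[n+1]C[k+1]; k>n⇒nCk≡0)
import Data.Nat.Properties as ℕₚ
open import Data.Nat.Tactic.RingSolver using () renaming (solve-∀ to ℕ-solve-∀)
open import Data.Integer.Base using (ℤ; 0ℤ; 1ℤ; _+_; _*_; -_)
import Data.Integer.Properties as ℤₚ
open import Data.Integer.Tactic.RingSolver using (solve-∀)
open import Data.List.Base using ([]; _∷_; foldr; applyUpTo)
open import Data.Product.Base using (proj₁; proj₂)
open import Data.Sum.Base using (inj₁; inj₂)
open import Function.Base using (_∘_)
open import Relation.Binary.PropositionalEquality
  using (_≡_; refl; sym; trans; cong; cong₂; module ≡-Reasoning)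
open ≡-Reasoning

-- Finite sums of integers.

Σ< : ℕ → (ℕ → ℤ) → ℤ
Σ< m f = foldr _+_ 0ℤ (applyUpTo f m)

Σ<-cong : ∀ m {f h : ℕ → ℤ} → (∀ k → k < m → f k ≡ h k) → Σ< m f ≡ Σ< m h
Σ<-cong zero    eq = refl
Σ<-cong (suc m) eq =
  cong₂ _+_ (eq 0 (s≤s z≤n)) (Σ<-cong m (λ k k<m → eq (suc k) (s≤s k<m)))

Σ<-linear : ∀ m a b (f h : ℕ → ℤ) →
  Σ< m (λ k → a * f k + b * h k) ≡ a * Σ< m f + b * Σ< m h
Σ<-linear zero    a b f h = sym (zeros a b)
  where
  zeros : ∀ a b → a * 0ℤ + b * 0ℤ ≡ 0ℤ
  zeros = solve-∀
Σ<-linear (suc m) a b f h = trans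
  (cong (λ z → a * f 0 + b * h 0 + z) (Σ<-linear m a b (f ∘ suc) (h ∘ suc)))
  (regroup a b (f 0) (h 0) (Σ< m (f ∘ suc)) (Σ< m (h ∘ suc)))
  where
  regroup : ∀ a b x y u v →
    a * x + b * y + (a * u + b * v) ≡ a * (x + u) + b * (y + v)
  regroup = solve-∀

Σ<-zero : ∀ m {f : ℕ → ℤ} → (∀ k → f k ≡ 0ℤ) → Σ< m f ≡ 0ℤ
Σ<-zero zero    eq = refl
Σ<-zero (suc m) eq = cong₂ _+_ (eq 0) (Σ<-zero m (eq ∘ suc))

Σ<-*ˡ : ∀ m a (f : ℕ → ℤ) → Σ< m (λ k → a * f k) ≡ a * Σ< m f
Σ<-*ˡ zero    a f = sym (ℤₚ.*-zeroʳ a)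
Σ<-*ˡ (suc m) a f = trans (cong (λ z → a * f 0 + z) (Σ<-*ˡ m a (f ∘ suc)))
  (sym (ℤₚ.*-distribˡ-+ a (f 0) (Σ< m (f ∘ suc))))

-- Turns a sum from 0 into one from `t`. If `m ≤ t`, truncated subtraction makes the right side
-- empty, and the left side has only zero terms.
Σ<-drop : ∀ t m (f : ℕ → ℤ) → (∀ k → k < t → f k ≡ 0ℤ) →
  Σ< m f ≡ Σ< (m ∸ t) (λ j → f (t ℕ.+ j))
Σ<-drop zero    m       f f≡0 = refl
Σ<-drop (suc t) zero    f f≡0 = refl
Σ<-drop (suc t) (suc m) f f≡0 = trans
  (cong₂ _+_ (f≡0 0 (s≤s z≤n))
    (Σ<-drop t m (f ∘ suc) (λ k k<t → f≡0 (suc k) (s≤s k<t))))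
  (ℤₚ.+-identityˡ _)

-- Coefficients of polynomials.

coeff-· : ∀ a p k → coeff (a · p) k ≡ a * coeff p k
coeff-· a []      k       = sym (ℤₚ.*-zeroʳ a)
coeff-· a (b ∷ p) zero    = refl
coeff-· a (b ∷ p) (suc k) = coeff-· a p k

coeff-⊞ : ∀ p q k → coeff (p ⊞ q) k ≡ coeff p k + coeff q k
coeff-⊞ []      q       k       = sym (ℤₚ.+-identityˡ _)
coeff-⊞ (a ∷ p) []      k       = sym (ℤₚ.+-identityʳ _)
coeff-⊞ (a ∷ p) (b ∷ q) zero    = refl
coeff-⊞ (a ∷ p) (b ∷ q) (suc k) = coeff-⊞ p q k

coeff-Σ : ∀ m (f : ℕ → Poly) k →
  coeff (foldr _⊞_ [] (applyUpTo f m)) k ≡ Σ< m (λ j → coeff (f j) k)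
coeff-Σ zero    f k = refl
coeff-Σ (suc m) f k =
  trans (coeff-⊞ (f 0) _ k) (cong (λ z → coeff (f 0) k + z) (coeff-Σ m (f ∘ suc) k))

coeff-linear-zero : ∀ a b p → coeff ((a ∷ b ∷ []) ⊠ p) 0 ≡ a * coeff p 0
coeff-linear-zero a b p = begin
  coeff ((a ∷ b ∷ []) ⊠ p) 0     ≡⟨ coeff-⊞ (a · p) _ 0 ⟩
  coeff (a · p) 0 + 0ℤ           ≡⟨ ℤₚ.+-identityʳ _ ⟩
  coeff (a · p) 0                ≡⟨ coeff-· a p 0 ⟩
  a * coeff p 0                  ∎

coeff-linear-suc : ∀ a b p k →
  coeff ((a ∷ b ∷ []) ⊠ p) (suc k) ≡ a * coeff p (suc k) + b * coeff p k
coeff-linear-suc a b p k = begin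
  coeff ((a ∷ b ∷ []) ⊠ p) (suc k)
    ≡⟨ coeff-⊞ (a · p) _ (suc k) ⟩
  coeff (a · p) (suc k) + coeff ((b · p) ⊞ (0ℤ ∷ [])) k
    ≡⟨ cong₂ _+_ (coeff-· a p (suc k)) (coeff-⊞ (b · p) (0ℤ ∷ []) k) ⟩
  a * coeff p (suc k) + (coeff (b · p) k + coeff (0ℤ ∷ []) k)
    ≡⟨ cong (λ z → a * coeff p (suc k) + (coeff (b · p) k + z)) (coeff-0 k) ⟩
  a * coeff p (suc k) + (coeff (b · p) k + 0ℤ)
    ≡⟨ cong (λ z → a * coeff p (suc k) + z)
         (trans (ℤₚ.+-identityʳ _) (coeff-· b p k)) ⟩
  a * coeff p (suc k) + b * coeff p k ∎
  where
  coeff-0 : ∀ k → coeff (0ℤ ∷ []) k ≡ 0ℤ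
  coeff-0 zero    = refl
  coeff-0 (suc k) = refl

coeff-X^suc-suc : ∀ t k → coeff (X ^ suc t) (suc k) ≡ coeff (X ^ t) k
coeff-X^suc-suc t k = trans (coeff-linear-suc 0ℤ 1ℤ (X ^ t) k)
  (trans (ℤₚ.+-identityˡ _) (ℤₚ.*-identityˡ _))

-- Only the term `t = k` survives, and the hypothesis covers a `k` beyond the range of summation.
-- The induction removes one factor `X` and lowers `k` at the same time.
coeff-ΣX^ : ∀ m (a : ℕ → ℤ) k → (m ≤ k → a k ≡ 0ℤ) →
  Σ< m (λ t → a t * coeff (X ^ t) k) ≡ a k
coeff-ΣX^ zero    a k       a≡0 = sym (a≡0 z≤n)
coeff-ΣX^ (suc m) a zero    a≡0 = trans
  (cong₂ _+_ (ℤₚ.*-identityʳ (a 0)) (Σ<-zero m λ t →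
    trans (cong (a (suc t) *_) (coeff-linear-zero 0ℤ 1ℤ (X ^ t)))
          (ℤₚ.*-zeroʳ (a (suc t)))))
  (ℤₚ.+-identityʳ (a 0))
coeff-ΣX^ (suc m) a (suc k) a≡0 = begin
  a 0 * 0ℤ + Σ< m (λ t → a (suc t) * coeff (X ^ suc t) (suc k))
    ≡⟨ cong₂ _+_ (ℤₚ.*-zeroʳ (a 0)) (Σ<-cong m λ t _ →
         cong (a (suc t) *_) (coeff-X^suc-suc t k)) ⟩
  0ℤ + Σ< m (λ t → a (suc t) * coeff (X ^ t) k)
    ≡⟨ ℤₚ.+-identityˡ _ ⟩
  Σ< m (λ t → a (suc t) * coeff (X ^ t) k)
    ≡⟨ coeff-ΣX^ m (a ∘ suc) k (λ m≤k → a≡0 (s≤s m≤k)) ⟩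
  a (suc k) ∎

-- Cauchy products of sequences.

conv : (ℕ → ℤ) → (ℕ → ℤ) → ℕ → ℤ
conv s f n = Σ< (suc n) (λ k → s k * f (n ∸ k))

-- As power series, s = s₀ + x(as + bu); multiply by f and compare coefficients of xⁿ⁺¹.
conv-recˡ : ∀ a b (s u f : ℕ → ℤ) → (∀ k → s (suc k) ≡ a * s k + b * u k) →
  ∀ n → conv s f (suc n) ≡ s 0 * f (suc n) + (a * conv s f n + b * conv u f n)
conv-recˡ a b s u f rec n = cong (λ z → s 0 * f (suc n) + z) (trans
  (Σ<-cong (suc n) λ k _ → trans (cong (_* f (n ∸ k)) (rec k))
                                  (expand a b (s k) (u k) (f (n ∸ k))))
  (Σ<-linear (suc n) a b (λ k → s k * f (n ∸ k)) (λ k → u k * f (n ∸ k))))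
  where
  expand : ∀ a b x y z → (a * x + b * y) * z ≡ a * (x * z) + b * (y * z)
  expand = solve-∀

-- The hypotheses say f = (1 + ax)h, hence sf = (1 + ax)sh. The induction splits off `s 0` and
-- passes to the shifted sequence `s ∘ suc`.
conv-recʳ : ∀ a (s f h : ℕ → ℤ) → f 0 ≡ h 0 →
  (∀ k → f (suc k) ≡ h (suc k) + a * h k) →
  ∀ n → conv s f (suc n) ≡ conv s h (suc n) + a * conv s h n
conv-recʳ a s f h eq₀ rec zero = trans
  (cong₂ (λ x y → s 0 * x + (s 1 * y + 0ℤ)) (rec 0) eq₀)
  (regroup a (s 0) (s 1) (h 0) (h 1))
  where
  regroup : ∀ a s₀ s₁ h₀ h₁ → s₀ * (h₁ + a * h₀) + (s₁ * h₀ + 0ℤ) ≡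
    s₀ * h₁ + (s₁ * h₀ + 0ℤ) + a * (s₀ * h₀ + 0ℤ)
  regroup = solve-∀
conv-recʳ a s f h eq₀ rec (suc n) = trans
  (cong₂ (λ x y → s 0 * x + y) (rec (suc n)) (conv-recʳ a (s ∘ suc) f h eq₀ rec n))
  (regroup a (s 0) (h (suc (suc n))) (h (suc n))
    (conv (s ∘ suc) h (suc n)) (conv (s ∘ suc) h n))
  where
  regroup : ∀ a s₀ x y u v → s₀ * (x + a * y) + (u + a * v) ≡
    s₀ * x + u + a * (s₀ * y + v)
  regroup = solve-∀

-- Recurrences for the coefficients of the expansion in λ.

-- The coefficients of (-x)ᵗ / (1 + 2x)ᵗ⁺¹.
S : ℕ → ℕ → ℤ
S t k = -1ℤ ℤ.^ k * + (k C t) * (+ 2) ℤ.^ (k ∸ t)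

-- The coefficients of (1 + 4x)ᵗ.
Q : ℕ → ℕ → ℤ
Q t j = + (t C j) * (+ 4) ℤ.^ j

-- The coefficients of (-x)ᵗ (1 + 4x)ᵗ⁺¹ / (1 + 2x)ᵗ⁺¹.
B : ℕ → ℕ → ℤ
B t = conv (S t) (Q (suc t))

+C-pascal : ∀ n k → + (suc n C suc k) ≡ + (n C k) + + (n C suc k)
+C-pascal n k = trans (cong +_ (sym (nCk+nC[k+1]≡[n+1]C[k+1] n k)))
  (ℤₚ.pos-+ (n C k) (n C suc k))

S-vanish : ∀ t k → k < t → S t k ≡ 0ℤ
S-vanish t k k<t = trans
  (cong (λ c → -1ℤ ℤ.^ k * + c * (+ 2) ℤ.^ (k ∸ t)) (k>n⇒nCk≡0 k<t))
  (cong (_* (+ 2) ℤ.^ (k ∸ t)) (ℤₚ.*-zeroʳ (-1ℤ ℤ.^ k)))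

-- The geometric series 1 / (1 + 2x). The null second summand gives the recurrence the shape that
-- `conv-recˡ` expects.
S-zero-suc : ∀ k → S 0 (suc k) ≡ - (+ 2) * S 0 k + 0ℤ * S 0 k
S-zero-suc k = regroup (-1ℤ ℤ.^ k) ((+ 2) ℤ.^ k)
  where
  regroup : ∀ σ τ → -1ℤ * σ * 1ℤ * (+ 2 * τ) ≡
    - (+ 2) * (σ * 1ℤ * τ) + 0ℤ * (σ * 1ℤ * τ)
  regroup = solve-∀

-- For `k ≤ t` the exponents are truncated, but there the binomial coefficient is zero; for `t < k`
-- the subtraction is genuine.
C*2^-suc : ∀ t k →
  + (k C suc t) * (+ 2) ℤ.^ (k ∸ t) ≡ + (k C suc t) * (+ 2 * (+ 2) ℤ.^ (k ∸ suc t))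
C*2^-suc t k with ℕₚ.≤-<-connex k t
... | inj₁ k≤t rewrite k>n⇒nCk≡0 (s≤s k≤t) = refl
... | inj₂ t<k = cong (λ e → + (k C suc t) * (+ 2) ℤ.^ e) (ℕₚ.+-∸-assoc 1 t<k)

-- Pascal's rule; in series form, (1 + 2x) Sₜ₊₁ = -x Sₜ.
S-suc-suc : ∀ t k → S (suc t) (suc k) ≡ - (+ 2) * S (suc t) k + -1ℤ * S t k
S-suc-suc t k = begin
  -1ℤ * σ * + (suc k C suc t) * τ
    ≡⟨ cong (λ c → -1ℤ * σ * c * τ) (+C-pascal k t) ⟩
  -1ℤ * σ * (+ (k C t) + + (k C suc t)) * τ
    ≡⟨ expand σ (+ (k C t)) (+ (k C suc t)) τ ⟩
  -1ℤ * (σ * + (k C t) * τ) + -1ℤ * σ * (+ (k C suc t) * τ)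
    ≡⟨ cong (λ z → -1ℤ * (σ * + (k C t) * τ) + -1ℤ * σ * z) (C*2^-suc t k) ⟩
  -1ℤ * (σ * + (k C t) * τ) + -1ℤ * σ * (+ (k C suc t) * (+ 2 * τ′))
    ≡⟨ regroup σ (+ (k C t)) (+ (k C suc t)) τ τ′ ⟩
  - (+ 2) * S (suc t) k + -1ℤ * S t k ∎
  where
  σ = -1ℤ ℤ.^ k
  τ = (+ 2) ℤ.^ (k ∸ t)
  τ′ = (+ 2) ℤ.^ (k ∸ suc t)
  expand : ∀ σ c d τ →
    -1ℤ * σ * (c + d) * τ ≡ -1ℤ * (σ * c * τ) + -1ℤ * σ * (d * τ)
  expand = solve-∀
  regroup : ∀ σ c d τ τ′ → -1ℤ * (σ * c * τ) + -1ℤ * σ * (d * (+ 2 * τ′)) ≡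
    - (+ 2) * (σ * d * τ′) + -1ℤ * (σ * c * τ)
  regroup = solve-∀

-- Pascal's rule again: one more factor 1 + 4x.
Q-suc-suc : ∀ t j → Q (suc t) (suc j) ≡ Q t (suc j) + + 4 * Q t j
Q-suc-suc t j = trans
  (cong (_* (+ 4 * (+ 4) ℤ.^ j)) (+C-pascal t j))
  (regroup (+ (t C j)) (+ (t C suc j)) ((+ 4) ℤ.^ j))
  where
  regroup : ∀ c d φ → (c + d) * (+ 4 * φ) ≡ d * (+ 4 * φ) + + 4 * (c * φ)
  regroup = solve-∀

-- From (1 + 2x) B₀ = 1 + 4x. The right side still contributes at x¹, so the ratio -2 only sets in
-- afterwards.
B-zero-suc-suc : ∀ n → B 0 (suc (suc n)) ≡ - (+ 2) * B 0 (suc n)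
B-zero-suc-suc n = trans
  (conv-recˡ (- (+ 2)) 0ℤ (S 0) (S 0) (Q 1) S-zero-suc (suc n))
  (drop (B 0 (suc n)))
  where
  -- The leading zero is `S 0 0 * Q 1 (suc (suc n))`, as 1 + 4x has no term of degree 2 or more.
  drop : ∀ x → 0ℤ + (- (+ 2) * x + 0ℤ) ≡ - (+ 2) * x
  drop = solve-∀

-- In series form, (1 + 2x) Bₜ₊₁ = -x(1 + 4x) Bₜ: the left factor of the product supplies -x / (1 +
-- 2x), the right factor 1 + 4x.
B-suc-suc-suc : ∀ t n → B (suc t) (suc (suc n)) ≡
  - (+ 2) * B (suc t) (suc n) + -1ℤ * (B t (suc n) + + 4 * B t n)
B-suc-suc-suc t n = begin
  B (suc t) (suc (suc n))
    ≡⟨ conv-recˡ (- (+ 2)) -1ℤ (S (suc t)) (S t) (Q (2 ℕ.+ t)) (S-suc-suc t) (suc n) ⟩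
  0ℤ + (- (+ 2) * B (suc t) (suc n) + -1ℤ * conv (S t) (Q (2 ℕ.+ t)) (suc n))
    ≡⟨ cong (λ y → 0ℤ + (- (+ 2) * B (suc t) (suc n) + -1ℤ * y))
         (conv-recʳ (+ 4) (S t) (Q (2 ℕ.+ t)) (Q (suc t)) refl (Q-suc-suc (suc t)) n) ⟩
  0ℤ + (- (+ 2) * B (suc t) (suc n) + -1ℤ * (B t (suc n) + + 4 * B t n))
    ≡⟨ ℤₚ.+-identityˡ _ ⟩
  - (+ 2) * B (suc t) (suc n) + -1ℤ * (B t (suc n) + + 4 * B t n) ∎

-- From the defining recurrence to a recurrence of order two.

-- The sum in the recurrence for g (suc n), with the index shifted to i = 2 + j.
tail : (ℕ → ℤ) → ℕ → ℤ
tail f n = Σ< n (λ j → recCoeff (2 ℕ.+ j) * f (n ∸ suc j))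

recCoeff-suc : ∀ j → recCoeff (3 ℕ.+ j) ≡ - (+ 4) * recCoeff (2 ℕ.+ j)
recCoeff-suc j = trans
  -- Raising the index brings two factors 2; one of them sits in the right summand of the exponent,
  -- and `+-suc` moves it out.
  (cong (λ e → -1ℤ * σ * (+ 2 * (+ 2) ℤ.^ e)) (ℕₚ.+-suc (suc j) (2 ℕ.+ j ℕ.+ 0)))
  (regroup σ ((+ 2) ℤ.^ (suc j ℕ.+ (2 ℕ.+ j ℕ.+ 0))))
  where
  σ = -1ℤ ℤ.^ (2 ℕ.+ j ℕ.+ 1)
  regroup : ∀ σ τ → -1ℤ * σ * (+ 2 * (+ 2 * τ)) ≡ - (+ 4) * (σ * τ)
  regroup = solve-∀

-- The weights are geometric with first value -8 and ratio -4, so after the first term the sum is -4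
-- times the previous one. This is what removes the dependence on all earlier polynomials.
tail-suc : ∀ f n → tail f (suc n) ≡ - (+ 8) * f n + - (+ 4) * tail f n
tail-suc f n = cong (λ z → - (+ 8) * f n + z) (trans
  (Σ<-cong n λ j _ → trans
    (cong (_* f (n ∸ suc j)) (recCoeff-suc j))
    (ℤₚ.*-assoc (- (+ 4)) (recCoeff (2 ℕ.+ j)) (f (n ∸ suc j))))
  (Σ<-*ˡ n (- (+ 4)) (λ j → recCoeff (2 ℕ.+ j) * f (n ∸ suc j))))

module _ (g : ℕ → Poly) (isG : IsG g) where

  coeff-tail : ∀ n k →
    coeff (∑[ 2 ≤ i ≤ suc n ] recCoeff i · g (suc n ∸ i)) k ≡
    tail (λ m → coeff (g m) k) n
  coeff-tail n k = trans (coeff-Σ n _ k)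
    (Σ<-cong n λ j _ → coeff-· (recCoeff (2 ℕ.+ j)) (g (n ∸ suc j)) k)

  coeff-step : ∀ n k → coeff (g (suc n)) k ≡
    coeff ((+ 2 ∷ -1ℤ ∷ []) ⊠ g n) k + tail (λ m → coeff (g m) k) n
  -- `const (+ 2) ⊟ X` computes to the list `+ 2 ∷ -1ℤ ∷ []`.
  coeff-step n k = trans (proj₂ isG (suc n) (s≤s z≤n) k)
    (trans (coeff-⊞ ((+ 2 ∷ -1ℤ ∷ []) ⊠ g n) _ k)
           (cong (λ z → coeff ((+ 2 ∷ -1ℤ ∷ []) ⊠ g n) k + z) (coeff-tail n k)))

  coeff-step-zero : ∀ n → coeff (g (suc n)) 0 ≡
    + 2 * coeff (g n) 0 + tail (λ m → coeff (g m) 0) n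
  coeff-step-zero n = trans (coeff-step n 0)
    (cong (_+ tail (λ m → coeff (g m) 0) n) (coeff-linear-zero (+ 2) -1ℤ (g n)))

  coeff-step-suc : ∀ n k → coeff (g (suc n)) (suc k) ≡
    + 2 * coeff (g n) (suc k) + -1ℤ * coeff (g n) k
    + tail (λ m → coeff (g m) (suc k)) n
  coeff-step-suc n k = trans (coeff-step n (suc k))
    (cong (_+ tail (λ m → coeff (g m) (suc k)) n) (coeff-linear-suc (+ 2) -1ℤ (g n) k))

  -- Multiplication by 1 + 4x in coefficients: the tail is eliminated by recognising -8x - 4w as -4
  -- times the preceding step.
  coeff-rec-zero : ∀ n →
    coeff (g (suc (suc n))) 0 ≡ - (+ 2) * coeff (g (suc n)) 0
  coeff-rec-zero n = begin
    coeff (g (suc (suc n))) 0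
      ≡⟨ coeff-step-zero (suc n) ⟩
    + 2 * y + tail f (suc n)
      ≡⟨ cong (λ z → + 2 * y + z) (tail-suc f n) ⟩
    + 2 * y + (- (+ 8) * x + - (+ 4) * tail f n)
      ≡⟨ factor x y (tail f n) ⟩
    + 2 * y + - (+ 4) * (+ 2 * x + tail f n)
      ≡⟨ cong (λ z → + 2 * y + - (+ 4) * z) (sym (coeff-step-zero n)) ⟩
    + 2 * y + - (+ 4) * y
      ≡⟨ collect y ⟩
    - (+ 2) * y ∎
    where
    f = λ m → coeff (g m) 0
    x = f n
    y = f (suc n)
    factor : ∀ x y w → + 2 * y + (- (+ 8) * x + - (+ 4) * w) ≡
      + 2 * y + - (+ 4) * (+ 2 * x + w)
    factor = solve-∀
    collect : ∀ y → + 2 * y + - (+ 4) * y ≡ - (+ 2) * y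
    collect = solve-∀

  -- The same elimination, now with the contribution of -λ. Completing the preceding step leaves
  -- over the term -4x′, which yields the factor 1 + 4x next to λ.
  coeff-rec-suc : ∀ n k → coeff (g (suc (suc n))) (suc k) ≡
    - (+ 2) * coeff (g (suc n)) (suc k)
    + -1ℤ * (coeff (g (suc n)) k + + 4 * coeff (g n) k)
  coeff-rec-suc n k = begin
    coeff (g (suc (suc n))) (suc k)
      ≡⟨ coeff-step-suc (suc n) k ⟩
    + 2 * y + -1ℤ * y′ + tail f (suc n)
      ≡⟨ cong (λ z → + 2 * y + -1ℤ * y′ + z) (tail-suc f n) ⟩
    + 2 * y + -1ℤ * y′ + (- (+ 8) * x + - (+ 4) * tail f n)
      ≡⟨ factor x x′ y y′ (tail f n) ⟩
    + 2 * y + -1ℤ * (y′ + + 4 * x′) + - (+ 4) * (+ 2 * x + -1ℤ * x′ + tail f n)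
      ≡⟨ cong (λ z → + 2 * y + -1ℤ * (y′ + + 4 * x′) + - (+ 4) * z)
           (sym (coeff-step-suc n k)) ⟩
    + 2 * y + -1ℤ * (y′ + + 4 * x′) + - (+ 4) * y
      ≡⟨ collect y (-1ℤ * (y′ + + 4 * x′)) ⟩
    - (+ 2) * y + -1ℤ * (y′ + + 4 * x′) ∎
    where
    f = λ m → coeff (g m) (suc k)
    x = f n
    y = f (suc n)
    x′ = coeff (g n) k
    y′ = coeff (g (suc n)) k
    factor : ∀ x x′ y y′ w →
      + 2 * y + -1ℤ * y′ + (- (+ 8) * x + - (+ 4) * w) ≡
      + 2 * y + -1ℤ * (y′ + + 4 * x′) + - (+ 4) * (+ 2 * x + -1ℤ * x′ + w)
    factor = solve-∀
    collect : ∀ y z → + 2 * y + z + - (+ 4) * y ≡ - (+ 2) * y + z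
    collect = solve-∀

  coeff-g[0]≡B : ∀ t → coeff (g 0) t ≡ B t 0
  coeff-g[0]≡B zero    = proj₁ isG 0
  coeff-g[0]≡B (suc t) = proj₁ isG (suc t)

  -- The sum from 2 to 1 is empty, so g₁ = 2 - λ.
  coeff-g[1]≡B : ∀ t → coeff (g 1) t ≡ B t 1
  coeff-g[1]≡B zero = trans (coeff-step-zero 0)
    (cong (λ x → + 2 * x + 0ℤ) (proj₁ isG 0))
  coeff-g[1]≡B (suc t) = trans (coeff-step-suc 0 t)
    (trans (cong₂ (λ x x′ → + 2 * x + -1ℤ * x′ + 0ℤ) (proj₁ isG (suc t)) (proj₁ isG t))
           (value t))
    where
    value : ∀ t → + 2 * 0ℤ + -1ℤ * coeff (const 1ℤ) t + 0ℤ ≡ B (suc t) 1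
    value zero    = refl
    value (suc t) = refl

  -- Both sides obey the same recurrence of order two in `n`, so the values at 0 and 1 determine
  -- them.
  coeff-g≡B : ∀ n t → coeff (g n) t ≡ B t n
  coeff-g≡B zero          t       = coeff-g[0]≡B t
  coeff-g≡B (suc zero)    t       = coeff-g[1]≡B t
  coeff-g≡B (suc (suc n)) zero    = begin
    coeff (g (suc (suc n))) 0        ≡⟨ coeff-rec-zero n ⟩
    - (+ 2) * coeff (g (suc n)) 0    ≡⟨ cong (- (+ 2) *_) (coeff-g≡B (suc n) 0) ⟩
    - (+ 2) * B 0 (suc n)            ≡⟨ sym (B-zero-suc-suc n) ⟩
    B 0 (suc (suc n))                ∎
  coeff-g≡B (suc (suc n)) (suc t) = begin
    coeff (g (suc (suc n))) (suc t)
      ≡⟨ coeff-rec-suc n t ⟩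
    - (+ 2) * coeff (g (suc n)) (suc t)
    + -1ℤ * (coeff (g (suc n)) t + + 4 * coeff (g n) t)
      ≡⟨ cong₂ (λ x y → - (+ 2) * x + -1ℤ * y)
           (coeff-g≡B (suc n) (suc t))
           (cong₂ (λ x y → x + + 4 * y) (coeff-g≡B (suc n) t) (coeff-g≡B n t)) ⟩
    - (+ 2) * B (suc t) (suc n) + -1ℤ * (B t (suc n) + + 4 * B t n)
      ≡⟨ sym (B-suc-suc-suc t n) ⟩
    B (suc t) (suc (suc n)) ∎

-- Identification with the stated double sum.

term : ℕ → ℕ → ℕ → ℤ
term n t k = -1ℤ ℤ.^ k * + (k C t) * + ((t ℕ.+ 1) C (n ∸ k)) * (+ 2) ℤ.^ (2 ℕ.* n ∸ t ∸ k)

term-vanish : ∀ n t k → k < t → term n t k ≡ 0ℤ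
term-vanish n t k k<t = begin
  σ * + (k C t) * c * τ   ≡⟨ cong (λ b → σ * + b * c * τ) (k>n⇒nCk≡0 k<t) ⟩
  σ * 0ℤ * c * τ          ≡⟨ cong (λ z → z * c * τ) (ℤₚ.*-zeroʳ σ) ⟩
  0ℤ                      ∎
  where
  σ = -1ℤ ℤ.^ k
  c = + ((t ℕ.+ 1) C (n ∸ k))
  τ = (+ 2) ℤ.^ (2 ℕ.* n ∸ t ∸ k)

-- Substitute k = t + d and n = k + e; then 2n - t - k = d + 2e, the exponent of 2 in 2ᵈ4ᵉ.
2n∸t∸k-split : ∀ {n t k} → t ≤ k → k ≤ n →
  2 ℕ.* n ∸ t ∸ k ≡ (k ∸ t) ℕ.+ 2 ℕ.* (n ∸ k)
2n∸t∸k-split {n} {t} {k} t≤k k≤n = begin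
  2 ℕ.* n ∸ t ∸ k
    ≡⟨ cong (λ m → 2 ℕ.* m ∸ t ∸ k) (sym (ℕₚ.m+[n∸m]≡n k≤n)) ⟩
  2 ℕ.* (k ℕ.+ e) ∸ t ∸ k
    ≡⟨ cong (λ m → m ∸ t ∸ k) (twice k e) ⟩
  k ℕ.+ (k ℕ.+ 2 ℕ.* e) ∸ t ∸ k
    ≡⟨ cong (λ m → m ℕ.+ (k ℕ.+ 2 ℕ.* e) ∸ t ∸ k) (sym (ℕₚ.m+[n∸m]≡n t≤k)) ⟩
  t ℕ.+ d ℕ.+ (k ℕ.+ 2 ℕ.* e) ∸ t ∸ k
    ≡⟨ cong (λ m → m ∸ t ∸ k) (swap t d k (2 ℕ.* e)) ⟩
  t ℕ.+ (k ℕ.+ (d ℕ.+ 2 ℕ.* e)) ∸ t ∸ k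
    ≡⟨ cong (_∸ k) (ℕₚ.m+n∸m≡n t _) ⟩
  k ℕ.+ (d ℕ.+ 2 ℕ.* e) ∸ k
    ≡⟨ ℕₚ.m+n∸m≡n k _ ⟩
  d ℕ.+ 2 ℕ.* e ∎
  where
  d = k ∸ t
  e = n ∸ k
  twice : ∀ k e → 2 ℕ.* (k ℕ.+ e) ≡ k ℕ.+ (k ℕ.+ 2 ℕ.* e)
  twice = ℕ-solve-∀
  swap : ∀ t d k u → t ℕ.+ d ℕ.+ (k ℕ.+ u) ≡ t ℕ.+ (k ℕ.+ (d ℕ.+ u))
  swap = ℕ-solve-∀

-- For `k < t` the exponents may differ through truncation, but the factor `k C t` makes both sides
-- zero. Otherwise the powers of 2 and 4 combine.
S*Q≡term : ∀ n t k → k ≤ n → S t k * Q (suc t) (n ∸ k) ≡ term n t k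
S*Q≡term n t k k≤n with ℕₚ.≤-<-connex t k
... | inj₂ k<t = trans (cong (_* Q (suc t) (n ∸ k)) (S-vanish t k k<t))
                       (sym (term-vanish n t k k<t))
... | inj₁ t≤k = begin
  σ * b * (+ 2) ℤ.^ d * (+ (suc t C e) * (+ 4) ℤ.^ e)
    ≡⟨ regroup σ b ((+ 2) ℤ.^ d) (+ (suc t C e)) ((+ 4) ℤ.^ e) ⟩
  σ * b * + (suc t C e) * ((+ 2) ℤ.^ d * (+ 4) ℤ.^ e)
    ≡⟨ cong₂ (λ u τ → σ * b * + (u C e) * τ) (ℕₚ.+-comm 1 t) powers ⟩
  σ * b * + ((t ℕ.+ 1) C e) * (+ 2) ℤ.^ (2 ℕ.* n ∸ t ∸ k) ∎
  where
  σ = -1ℤ ℤ.^ k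
  b = + (k C t)
  d = k ∸ t
  e = n ∸ k
  powers : (+ 2) ℤ.^ d * (+ 4) ℤ.^ e ≡ (+ 2) ℤ.^ (2 ℕ.* n ∸ t ∸ k)
  powers = begin
    (+ 2) ℤ.^ d * (+ 4) ℤ.^ e           ≡⟨ cong ((+ 2) ℤ.^ d *_) (ℤₚ.^-*-assoc (+ 2) 2 e) ⟩
    (+ 2) ℤ.^ d * (+ 2) ℤ.^ (2 ℕ.* e)   ≡⟨ sym (ℤₚ.^-distribˡ-+-* (+ 2) d (2 ℕ.* e)) ⟩
    (+ 2) ℤ.^ (d ℕ.+ 2 ℕ.* e)           ≡⟨ cong ((+ 2) ℤ.^_) (sym (2n∸t∸k-split t≤k k≤n)) ⟩
    (+ 2) ℤ.^ (2 ℕ.* n ∸ t ∸ k)         ∎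
  regroup : ∀ σ b τ c φ → σ * b * τ * (c * φ) ≡ σ * b * c * (τ * φ)
  regroup = solve-∀

B≡Σterm : ∀ n t → B t n ≡ Σ< (suc n ∸ t) (λ j → term n t (t ℕ.+ j))
B≡Σterm n t = trans
  (Σ<-cong (suc n) λ { k (s≤s k≤n) → S*Q≡term n t k k≤n })
  (Σ<-drop t (suc n) (term n t) (term-vanish n t))

-- The range t ≤ k ≤ n is empty. This bounds the degree of gₙ by n.
B-vanish : ∀ n t → n < t → B t n ≡ 0ℤ
B-vanish n t n<t = trans (B≡Σterm n t)
  (cong (λ m → Σ< m (λ j → term n t (t ℕ.+ j))) (ℕₚ.m≤n⇒m∸n≡0 n<t))

-- The power of `X` does not depend on the inner index and factors out.
coeff-inner : ∀ n t k →
  coeff (∑[ t ≤ i ≤ n ] term n t i · X ^ t) k ≡ B t n * coeff (X ^ t) k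
coeff-inner n t k = begin
  coeff (∑[ t ≤ i ≤ n ] term n t i · X ^ t) k
    ≡⟨ coeff-Σ m _ k ⟩
  Σ< m (λ j → coeff (term n t (t ℕ.+ j) · X ^ t) k)
    ≡⟨ Σ<-cong m (λ j _ → trans (coeff-· (term n t (t ℕ.+ j)) (X ^ t) k)
                                 (ℤₚ.*-comm (term n t (t ℕ.+ j)) x)) ⟩
  Σ< m (λ j → x * term n t (t ℕ.+ j))
    ≡⟨ Σ<-*ˡ m x (λ j → term n t (t ℕ.+ j)) ⟩
  x * Σ< m (λ j → term n t (t ℕ.+ j))
    ≡⟨ cong (x *_) (sym (B≡Σterm n t)) ⟩
  x * B t n
    ≡⟨ ℤₚ.*-comm x (B t n) ⟩
  B t n * x ∎
  where
  m = suc n ∸ t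
  x = coeff (X ^ t) k

theorem10 : (g : ℕ → Poly) → IsG g → (n : ℕ) →
    g n ≈ (∑[ 0 ≤ t ≤ n ] ∑[ t ≤ k ≤ n ]
    (-1ℤ ℤ.^ k ℤ.* + (k C t) ℤ.* + ((t ℕ.+ 1) C (n ∸ k)) ℤ.* (+ 2) ℤ.^ (2 ℕ.* n ∸ t ∸ k)) · X ^ t)
theorem10 g isG n k = begin
  coeff (g n) k
    ≡⟨ coeff-g≡B g isG n k ⟩
  B k n
    -- For `k` above `n` no power in the sum matches, and `B-vanish` supplies the zero.
    ≡⟨ sym (coeff-ΣX^ (suc n) (λ t → B t n) k (B-vanish n k)) ⟩
  Σ< (suc n) (λ t → B t n * coeff (X ^ t) k)
    ≡⟨ sym (Σ<-cong (suc n) λ t _ → coeff-inner n t k) ⟩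
  Σ< (suc n) (λ t → coeff (∑[ t ≤ i ≤ n ] term n t i · X ^ t) k)
    ≡⟨ sym (coeff-Σ (suc n) (λ t → ∑[ t ≤ i ≤ n ] term n t i · X ^ t) k) ⟩
  coeff (∑[ 0 ≤ t ≤ n ] ∑[ t ≤ i ≤ n ] term n t i · X ^ t) k ∎
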